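{- For every set $\Gamma\cup\{\varphi\}\subseteq For(\Sigma)$, if $\Gamma\vDash_{DCila}\varphi$, then $\Gamma\vdash_{DCila}\varphi$.
   Context: **Syntax.** $For(\Sigma)$ is the set of formulas generated from a denumerable set of propositional variables by the signature $\Sigma=\{\to,\neg,\lor,\land,\mathsf{O},\circ\}$ ($\neg,\mathsf{O},\circ$ unary; $\to,\lor,\land$ binary). **The logic $DCila$.** Hilbert calculus whose axiom schemas are those of $CPL^+$, the positive fragment of classical propositional logic in $\to,\land,\lor$ (for instance: $\alpha\to(\beta\to\alpha)$; $(\alpha\to(\beta\to\gamma))\to((\alpha\to\beta)\to(\alpha\to\gamma))$; $\alpha\to(\beta\to(\alpha\land\beta))$; $(\alpha\land\beta)\to\alpha$; $(\alpha\land\beta)\to\beta$; $\alpha\to(\alpha\lor\beta)$; $\beta\to(\alpha\lor\beta)$; $(\alpha\to\gamma)\to((\beta\to\gamma)\to((\alpha\lor\beta)\to\gamma))$; $\alpha\lor(\alpha\to\beta)$), plus (EM) $\alpha\lor\neg\alpha$; (bc) $\circ\alpha\to(\alpha\to(\neg\alpha\to\beta))$; ($\mathsf{O}$-K) $\mathsf{O}(\alpha\to\beta)\to(\mathsf{O}\alpha\to\mathsf{O}\beta)$; ($\mathsf{O}$-E) $\mathsf{O}\bot_\alpha\to\bot_\alpha$, where $\bot_\alpha:=(\alpha\land\neg\alpha)\land\circ\alpha$; (ci) $\neg\circ\alpha\to(\alpha\land\neg\alpha)$; (cl) $\neg(\alpha\land\neg\alpha)\to\circ\alpha$; (cf) $\neg\neg\alpha\to\alpha$;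 and (ca$_\#$) $(\circ\alpha\land\circ\beta)\to\circ(\alpha\#\beta)$ for each $\#\in\{\land,\lor,\to\}$. The rules are Modus Ponens and $\mathsf{O}$-necessitation (from $\varphi$ infer $\mathsf{O}\varphi$). $\vdash_{DCila}\varphi$ means that there is a finite derivation of $\varphi$ from axioms (no premises) using the rules. $\Gamma\vdash_{DCila}\varphi$ means: either $\vdash_{DCila}\varphi$, or there are $\gamma_1,\dots,\gamma_k\in\Gamma$ ($k\ge 1$ finite) with $\vdash_{DCila}(\gamma_1\land\dots\land\gamma_k)\to\varphi$. **Semantics.** Let $A=\{T,t,F\}$ with $T=(1,0)$, $t=(1,1)$, $F=(0,1)$; for $a\in A$ write $a=(a_1,a_2)$. Designated values: $\mathcal{D}=\{T,t\}$. Let $\sqcap,\sqcup,\supset,{\sim}$ be the Boolean meet, join, implication and complement on $\{0,1\}$, and $\bigwedge$ the meet of a non-empty subset. For $a,b\in A$, $\emptyset\neq X\subseteq A$: - $a\,\tilde\land\,b=\{c\in A: c_1=a_1\sqcap b_1\}$; $a\,\tilde\lor\,b=\{c\in A: c_1=a_1\sqcup b_1\}$; $a\,\tilde\to\,b=\{c\in A: c_1=a_1\supset b_1\}$; - $\tilde\neg_1 a=\{c\in A: c_1=a_2\text{ and }c_2\le a_1\}$; $\tilde\circ_2 a=\{({\sim}(a_1\sqcap a_2),\,a_1\sqcap a_2)\}$; - $\tilde{\mathsf{O}}(X)=\{c\in A: c_1=\bigwedge\{x_1:x\in X\}\}$. A swap Kripke model for $DCila$ is a triple $\langle W,R,\{v_w\}_{w\in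 W}\rangle$ where $W\ne\emptyset$, $R\subseteq W^2$ is serial (every $w$ has some $w'$ with $wRw'$), and each $v_w:For(\Sigma)\to A$ satisfies, for all $\alpha,\beta$ and all $\#\in\{\land,\lor,\to\}$: $v_w(\alpha\#\beta)\in v_w(\alpha)\,\tilde\#\,v_w(\beta)$; $v_w(\neg\alpha)\in\tilde\neg_1 v_w(\alpha)$; $v_w(\circ\alpha)\in\tilde\circ_2 v_w(\alpha)$; $v_w(\mathsf{O}\alpha)\in\tilde{\mathsf{O}}(\{v_{w'}(\alpha): wRw'\})$; and, in addition: if $v_w(\alpha)=t$ then $v_w(\alpha\land\neg\alpha)=T$; if $v_w(\alpha),v_w(\beta)\in\{T,F\}$ then $v_w(\alpha\#\beta)\in\{T,F\}$. $\mathcal{M},w\vDash\alpha$ means $v_w(\alpha)\in\mathcal{D}$; $\mathcal{M},w\vDash\Gamma$ means $\mathcal{M},w\vDash\gamma$ for all $\gamma\in\Gamma$. $\Gamma\vDash_{DCila}\alpha$ means: for every swap Kripke model $\mathcal{M}$ for $DCila$ and every world $w$ of it, $\mathcal{M},w\vDash\Gamma$ implies $\mathcal{M},w\vDash\alpha$. -}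

module Defs where

open import Data.Bool.Base as 𝔹 using (Bool; true; false)
open import Data.List.NonEmpty.Base using (List⁺; foldr₁)
open import Data.List.NonEmpty.Relation.Unary.All using (All)
open import Data.Nat.Base using (ℕ)
open import Data.Product.Base using (_×_; _,_; proj₁; proj₂; ∃; ∃-syntax; Σ-syntax)
open import Data.Sum.Base using (_⊎_)
open import Level using (0ℓ; suc)
open import Relation.Binary.Core using (Rel)
open import Relation.Binary.PropositionalEquality.Core using (_≡_)
open import Relation.Unary using (Pred; _∈_; _∪_; ｛_｝)

data Connective : Set where
  and or imp : Connective

infix  9 ¬_ ○_ O_
infixr 8 _∧_
infixr 7 _∨_
infixr 6 _⇒_
infix  5 _⟨_⟩_

data For : Set where
  var   : ℕ → For
  _⟨_⟩_ : For → Connective → For → For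
  ¬_    : For → For
  ○_    : For → For
  O_    : For → For

pattern _∧_ α β = α ⟨ and ⟩ β
pattern _∨_ α β = α ⟨ or ⟩ β
pattern _⇒_ α β = α ⟨ imp ⟩ β

bot : For → For
bot α = (α ∧ ¬ α) ∧ ○ α

data Axiom : Pred For 0ℓ where
  →-K  : ∀ α β   → Axiom (α ⇒ (β ⇒ α))
  →-S  : ∀ α β γ → Axiom ((α ⇒ (β ⇒ γ)) ⇒ ((α ⇒ β) ⇒ (α ⇒ γ)))
  ∧-I  : ∀ α β   → Axiom (α ⇒ (β ⇒ (α ∧ β)))
  ∧-E₁ : ∀ α β   → Axiom ((α ∧ β) ⇒ α)
  ∧-E₂ : ∀ α β   → Axiom ((α ∧ β) ⇒ β)
  ∨-I₁ : ∀ α β   → Axiom (α ⇒ (α ∨ β))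
  ∨-I₂ : ∀ α β   → Axiom (β ⇒ (α ∨ β))
  ∨-E  : ∀ α β γ → Axiom ((α ⇒ γ) ⇒ ((β ⇒ γ) ⇒ ((α ∨ β) ⇒ γ)))
  ∨-⇒  : ∀ α β   → Axiom (α ∨ (α ⇒ β))
  EM   : ∀ α     → Axiom (α ∨ ¬ α)
  bc   : ∀ α β   → Axiom (○ α ⇒ (α ⇒ (¬ α ⇒ β)))
  O-K  : ∀ α β   → Axiom (O (α ⇒ β) ⇒ (O α ⇒ O β))
  O-E  : ∀ α     → Axiom (O (bot α) ⇒ bot α)
  ci   : ∀ α     → Axiom (¬ (○ α) ⇒ (α ∧ ¬ α))
  cl   : ∀ α     → Axiom (¬ (α ∧ ¬ α) ⇒ ○ α)
  cf   : ∀ α     → Axiom (¬ (¬ α) ⇒ α)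
  ca   : ∀ # α β → Axiom ((○ α ∧ ○ β) ⇒ ○ (α ⟨ # ⟩ β))

infix 4 ⊢_ _⊢_ _⊨_

data ⊢_ : Pred For 0ℓ where
  axiom : ∀ {φ}   → Axiom φ → ⊢ φ
  MP    : ∀ {φ ψ} → ⊢ φ → ⊢ (φ ⇒ ψ) → ⊢ ψ
  O-nec : ∀ {φ}   → ⊢ φ → ⊢ O φ

-- ⋀ (γ₁ ∷ … ∷ γₖ ∷ []) is γ₁ ∧ (γ₂ ∧ (… ∧ γₖ)), and just γ₁ when k = 1.
⋀ : List⁺ For → For
⋀ = foldr₁ _∧_

_⊢_ : Pred For 0ℓ → For → Set
Γ ⊢ φ = (⊢ φ) ⊎ (Σ[ γs ∈ List⁺ For ] All (_∈ Γ) γs × (⊢ (⋀ γs ⇒ φ)))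

data A : Set where
  T t F : A

⟦_⟧ : A → Bool × Bool
⟦ T ⟧ = true  , false
⟦ t ⟧ = true  , true
⟦ F ⟧ = false , true

infix 10 _₁ _₂

_₁ _₂ : A → Bool
a ₁ = proj₁ ⟦ a ⟧
a ₂ = proj₂ ⟦ a ⟧

Designated Classical : Pred A 0ℓ
Designated = ｛ T ｝ ∪ ｛ t ｝
Classical  = ｛ T ｝ ∪ ｛ F ｝

boolOp : Connective → Bool → Bool → Bool
boolOp and x y = x 𝔹.∧ y
boolOp or  x y = x 𝔹.∨ y
boolOp imp x y = 𝔹.not x 𝔹.∨ y

-- The infimum in the order false ≤ true.  It is specified rather than computed,
-- since membership in a subset of Bool need not be decidable.
IsMeet : Bool → Pred Bool 0ℓ → Set
IsMeet b S = (∀ s → s ∈ S → b 𝔹.≤ s) × (∀ d → (∀ s → s ∈ S → d 𝔹.≤ s) → d 𝔹.≤ b)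

binary~ : Connective → A → A → Pred A 0ℓ
binary~ # a b c = c ₁ ≡ boolOp # (a ₁) (b ₁)

¬~ : A → Pred A 0ℓ
¬~ a c = c ₁ ≡ a ₂ × c ₂ 𝔹.≤ a ₁

○~ : A → Pred A 0ℓ
○~ a c = ⟦ c ⟧ ≡ (𝔹.not (a ₁ 𝔹.∧ a ₂) , a ₁ 𝔹.∧ a ₂)

-- Only ever applied to non-empty X, because accessibility is serial.
O~ : Pred A 0ℓ → Pred A 0ℓ
O~ X c = IsMeet (c ₁) (λ b → ∃[ x ] x ∈ X × x ₁ ≡ b)

record Model : Set (suc 0ℓ) where
  field
    W        : Set
    w₀       : W
    R        : Rel W 0ℓ
    serial   : ∀ w → ∃[ w′ ] R w w′
    v        : W → For → A
    v-binary : ∀ w # α β → v w (α ⟨ # ⟩ β) ∈ binary~ # (v w α) (v w β)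
    v-¬      : ∀ w α → v w (¬ α) ∈ ¬~ (v w α)
    v-○      : ∀ w α → v w (○ α) ∈ ○~ (v w α)
    v-O      : ∀ w α → v w (O α) ∈ O~ (λ x → ∃[ w′ ] R w w′ × v w′ α ≡ x)
    v-cl     : ∀ w α → v w α ≡ t → v w (α ∧ ¬ α) ≡ T
    v-ca     : ∀ w # α β → v w α ∈ Classical → v w β ∈ Classical →
               v w (α ⟨ # ⟩ β) ∈ Classical

infix 4 _,_⊩_

_,_⊩_ : (M : Model) → Model.W M → For → Set
M , w ⊩ α = Model.v M w α ∈ Designated

-- For arbitrary Γ, that Γ ⊨ φ implies Γ ⊢ φ is inherently classical: take
-- Γ = {bot p | P} and φ = bot p; then ¬¬P gives Γ ⊨ φ, but Γ ⊢ φ gives P.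
_⊨_ : Pred For 0ℓ → For → Set₁
Γ ⊨ α = ∀ (M : Model) (w : Model.W M) → (∀ γ → γ ∈ Γ → M , w ⊩ γ) → M , w ⊩ α

{-# OPTIONS --safe #-}

-- Completeness by a canonical model.  Its worlds are the two-valued functions
-- on formulas that respect ∧, ∨ and ⇒, verify every theorem and refute every
-- bot α.  Such a world h gives α the value whose coordinates are h α and,
-- for true α, h (¬ α); the axioms bc, ci, cl, cf and ca make these values
-- meet the conditions on a swap model.  Since O is a normal modality, a
-- formula whose O is refuted at h does not follow from {β | h (O β)}, so
-- Lindenbaum's lemma yields an accessible world refuting it; for bot α, this
-- and O-E yield seriality.
module Submission where

open import Defs
open import Axiom.ExcludedMiddle using (ExcludedMiddle)
open import Data.Bool.Base as 𝔹 using (Bool; true; false)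
open import Data.Bool.Properties using (≤-minimum; ≤-maximum)
open import Data.Empty using (⊥-elim)
open import Data.List.Base
  using (List; []; _∷_; _++_; map; upTo; cartesianProductWith)
open import Data.List.Membership.Propositional using () renaming (_∈_ to _∈ˡ_)
open import Data.List.Membership.Propositional.Properties
  using (∈-++⁺ˡ; ∈-++⁺ʳ; ∈-map⁺; ∈-upTo⁺; ∈-cartesianProductWith⁺)
open import Data.List.NonEmpty.Base using (_∷_)
open import Data.List.NonEmpty.Relation.Unary.All using (_∷_)
open import Data.List.Relation.Unary.All as List using ([]; _∷_)
open import Data.List.Relation.Unary.All.Properties using (++⁺)
open import Data.List.Relation.Unary.Any using (here; there)
open import Data.Nat.Base using (ℕ; zero; suc; _⊔_; _≤_; _≤′_; ≤′-refl; ≤′-step; s≤s)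
open import Data.Nat.Properties
  using (m≤m⊔n; m≤n⊔m; ≤-refl; ≤-trans; ≤⇒≤′)
open import Data.Product.Base using (_×_; _,_; ∃-syntax)
open import Data.Sum.Base using (_⊎_; inj₁; inj₂; [_,_])
open import Level using (0ℓ)
open import Relation.Binary.PropositionalEquality
  using (_≡_; refl; sym; trans; cong)
open import Relation.Nullary using (yes; no; does) renaming (¬_ to Not)
open import Relation.Nullary.Decidable using (dec-true; dec-false)
open import Relation.Unary using (Pred; _∈_; _⊆_; _∪_; ｛_｝; ⋃)

-- Derivability from premises; O-necessitation applies to theorems only.

infix 4 _⊩_

data _⊩_ (Γ : Pred For 0ℓ) : Pred For 0ℓ where
  hyp : ∀ {φ} → φ ∈ Γ → Γ ⊩ φ
  thm : ∀ {φ} → ⊢ φ → Γ ⊩ φ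
  mp  : ∀ {φ ψ} → Γ ⊩ φ ⇒ ψ → Γ ⊩ φ → Γ ⊩ ψ

variable
  Γ Δ : Pred For 0ℓ
  φ ψ χ : For

ax : Axiom φ → Γ ⊩ φ
ax a = thm (axiom a)

cut : (∀ {γ} → γ ∈ Γ → Δ ⊩ γ) → Γ ⊩ φ → Δ ⊩ φ
cut f (hyp p)  = f p
cut f (thm p)  = thm p
cut f (mp p q) = mp (cut f p) (cut f q)

weaken : Γ ⊆ Δ → Γ ⊩ φ → Δ ⊩ φ
weaken s = cut (λ p → hyp (s p))

⇒-refl : Γ ⊩ φ ⇒ φ
⇒-refl {φ = φ} = mp (mp (ax (→-S φ (φ ⇒ φ) φ)) (ax (→-K φ (φ ⇒ φ)))) (ax (→-K φ φ))

-- Necessitation never acts on a premise, so `mp` is the only rule to treat, and `→-S` distributes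
-- the discharged premise over it.
deduction : Γ ∪ ｛ φ ｝ ⊩ ψ → Γ ⊩ φ ⇒ ψ
deduction (hyp (inj₁ p))    = mp (ax (→-K _ _)) (hyp p)
deduction (hyp (inj₂ refl)) = ⇒-refl
deduction (thm p)           = mp (ax (→-K _ _)) (thm p)
deduction (mp p q)          = mp (mp (ax (→-S _ _ _)) (deduction p)) (deduction q)

theorems-closed : (∀ {γ} → γ ∈ Γ → ⊢ γ) → Γ ⊩ φ → ⊢ φ
theorems-closed f (hyp p)  = f p
theorems-closed f (thm p)  = p
theorems-closed f (mp p q) = MP (theorems-closed f q) (theorems-closed f p)

finite-support : Γ ⊩ φ → ∃[ γs ] List.All (_∈ Γ) γs × (_∈ˡ γs) ⊩ φ
finite-support (hyp p) = _ ∷ [] , p ∷ [] , hyp (here refl)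
finite-support (thm p) = [] , [] , thm p
finite-support (mp p q) =
  let γs , γs∈Γ , p′ = finite-support p
      δs , δs∈Γ , q′ = finite-support q
  in γs ++ δs , ++⁺ γs∈Γ δs∈Γ , mp (weaken ∈-++⁺ˡ p′) (weaken (∈-++⁺ʳ γs) q′)

⋀-elim : ∀ γ γs → Δ ⊩ ⋀ (γ ∷ γs) → φ ∈ˡ γ ∷ γs → Δ ⊩ φ
⋀-elim γ []       p (here refl) = p
⋀-elim γ (_ ∷ _)  p (here refl) = mp (ax (∧-E₁ _ _)) p
⋀-elim γ (δ ∷ γs) p (there i)   = ⋀-elim δ γs (mp (ax (∧-E₂ _ _)) p) i

⊩⇒⊢ : Γ ⊩ φ → Γ ⊢ φ
⊩⇒⊢ p with finite-support p
-- `⋀` takes non-empty lists only, so an empty support must give the first disjunct of `_⊢_`.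
... | []     , _       , q = inj₁ (theorems-closed (λ ()) q)
... | γ ∷ γs , γ∈ ∷ γs∈ , q =
  inj₂ (γ ∷ γs , γ∈ ∷ γs∈ , theorems-closed (λ ())
    -- Over the empty context, the single premise `⋀ (γ ∷ γs)` replaces the whole support and is
    -- then discharged.
    (deduction {Γ = _∈ˡ []} (cut (⋀-elim γ γs (hyp (inj₂ refl))) q)))

∨-cases : Γ ⊩ φ ∨ χ → Γ ⊩ φ ⇒ ψ → Γ ⊩ χ ⇒ ψ → Γ ⊩ ψ
∨-cases d p q = mp (mp (mp (ax (∨-E _ _ _)) p) q) d

-- The conjuncts of `bot φ` are the three antecedents of `bc`.
explosion : Γ ⊩ bot φ → Γ ⊩ ψ
explosion p = mp (mp (mp (ax (bc _ _)) (mp (ax (∧-E₂ _ _)) p)) (mp (ax (∧-E₁ _ _)) p₁))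
                 (mp (ax (∧-E₂ _ _)) p₁)
  where p₁ = mp (ax (∧-E₁ _ _)) p

-- Finite lists exhausting the formulas by depth

depth : For → ℕ
-- Counting the index leaves only finitely many variables below each depth.
depth (var n)     = suc n
depth (α ⟨ _ ⟩ β) = suc (depth α ⊔ depth β)
depth (¬ α)       = suc (depth α)
depth (○ α)       = suc (depth α)
depth (O α)       = suc (depth α)

formulas : ℕ → List For
formulas zero = []
formulas (suc n) =
  map var (upTo (suc n)) ++ map ¬_ αs ++ map ○_ αs ++ map O_ αs ++
  compounds and ++ compounds or ++ compounds imp
  where
  αs = formulas n
  compounds : Connective → List For
  compounds # = cartesianProductWith _⟨ # ⟩_ αs αs

∈-formulas : ∀ α {n} → depth α ≤ n → α ∈ˡ formulas n
∈-formulas (var k) (s≤s k≤n) = ∈-++⁺ˡ (∈-map⁺ var (∈-upTo⁺ (s≤s k≤n)))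
∈-formulas (¬ α) (s≤s {n = n} l) =
  ∈-++⁺ʳ (map var (upTo (suc n))) (∈-++⁺ˡ (∈-map⁺ ¬_ (∈-formulas α l)))
∈-formulas (○ α) (s≤s {n = n} l) =
  ∈-++⁺ʳ (map var (upTo (suc n))) (∈-++⁺ʳ (map ¬_ (formulas n))
    (∈-++⁺ˡ (∈-map⁺ ○_ (∈-formulas α l))))
∈-formulas (O α) (s≤s {n = n} l) =
  ∈-++⁺ʳ (map var (upTo (suc n))) (∈-++⁺ʳ (map ¬_ (formulas n))
    (∈-++⁺ʳ (map ○_ (formulas n)) (∈-++⁺ˡ (∈-map⁺ O_ (∈-formulas α l)))))
∈-formulas (α ⟨ # ⟩ β) (s≤s {n = n} l) =
  ∈-++⁺ʳ (map var (upTo (suc n))) (∈-++⁺ʳ (map ¬_ (formulas n))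
    (∈-++⁺ʳ (map ○_ (formulas n)) (∈-++⁺ʳ (map O_ (formulas n)) (∈-compounds #))))
  where
  compound : ∀ # → α ⟨ # ⟩ β ∈ˡ cartesianProductWith _⟨ # ⟩_ (formulas n) (formulas n)
  compound # = ∈-cartesianProductWith⁺ _⟨ # ⟩_
    (∈-formulas α (≤-trans (m≤m⊔n _ _) l)) (∈-formulas β (≤-trans (m≤n⊔m _ _) l))
  ∈-compounds : ∀ # → α ⟨ # ⟩ β ∈ˡ _
  ∈-compounds and = ∈-++⁺ˡ (compound and)
  ∈-compounds or  =
    ∈-++⁺ʳ (cartesianProductWith _∧_ (formulas n) (formulas n)) (∈-++⁺ˡ (compound or))
  ∈-compounds imp =
    ∈-++⁺ʳ (cartesianProductWith _∧_ (formulas n) (formulas n))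
      (∈-++⁺ʳ (cartesianProductWith _∨_ (formulas n) (formulas n)) (compound imp))

-- Worlds of the canonical model.

record World : Set where
  field
    holds     : For → Bool
    hom       : ∀ # α β → holds (α ⟨ # ⟩ β) ≡ boolOp # (holds α) (holds β)
    sound     : ∀ {α} → ⊢ α → holds α ≡ true
    bot-false : ∀ α → holds (bot α) ≡ false

  modus-ponens : ∀ {α β} → ⊢ α ⇒ β → holds α ≡ true → holds β ≡ true
  modus-ponens {α} {β} p a with holds α | holds β | hom imp α β | sound p
  ... | true  | true  | _ | _ = refl
  ... | true  | false | e | s = trans (sym e) s
  modus-ponens p () | false | _ | _ | _

open World using (holds)

-- Lindenbaum's lemma: extending `Γ` maximally without deriving `ψ`

module Lindenbaum (em : ExcludedMiddle 0ℓ) (Γ : Pred For 0ℓ) (ψ : For)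
                  (Γ⊮ψ : Not (Γ ⊩ ψ)) where

  -- The consistency test is a clause of membership, so the construction makes no case distinction;
  -- excluded middle enters only in its analysis.
  step : Pred For 0ℓ → For → Pred For 0ℓ
  step Θ α β = β ∈ Θ ⊎ (α ≡ β × Not (Θ ∪ ｛ α ｝ ⊩ ψ))

  extend : Pred For 0ℓ → List For → Pred For 0ℓ
  extend Θ []       = Θ
  extend Θ (α ∷ αs) = extend (step Θ α) αs

  -- Rejection is expressed through `ψ` because the negation is paraconsistent: `¬ α` does not
  -- exclude `α`.
  Decides : Pred For 0ℓ → For → Set
  Decides Θ α = α ∈ Θ ⊎ Θ ⊩ α ⇒ ψ

  decides-mono : ∀ {Θ Ξ α} → Θ ⊆ Ξ → Decides Θ α → Decides Ξ α
  decides-mono s (inj₁ p) = inj₁ (s p)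
  decides-mono s (inj₂ p) = inj₂ (weaken s p)

  step-decides : ∀ Θ α → Decides (step Θ α) α
  step-decides Θ α with em {Θ ∪ ｛ α ｝ ⊩ ψ}
  ... | yes p = inj₂ (weaken inj₁ (deduction p))
  ... | no ¬p = inj₁ (inj₂ (refl , ¬p))

  -- If `α` would yield `ψ`, the step adds nothing; otherwise it adds at most `α`, which is
  -- harmless.
  step-consistent : ∀ Θ α → Not (Θ ⊩ ψ) → Not (step Θ α ⊩ ψ)
  step-consistent Θ α Θ⊮ψ p with em {Θ ∪ ｛ α ｝ ⊩ ψ}
  ... | yes q = Θ⊮ψ (weaken [ (λ x → x) , (λ (_ , ¬q) → ⊥-elim (¬q q)) ] p)
  ... | no ¬q = ¬q (weaken (λ { (inj₁ x) → inj₁ x ; (inj₂ (e , _)) → inj₂ e }) p)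

  ⊆-extend : ∀ Θ αs → Θ ⊆ extend Θ αs
  ⊆-extend Θ []       p = p
  ⊆-extend Θ (α ∷ αs) p = ⊆-extend (step Θ α) αs (inj₁ p)

  extend-decides : ∀ Θ αs {α} → α ∈ˡ αs → Decides (extend Θ αs) α
  extend-decides Θ (α ∷ αs) (here refl) =
    decides-mono (⊆-extend (step Θ α) αs) (step-decides Θ α)
  extend-decides Θ (α ∷ αs) (there i) = extend-decides (step Θ α) αs i

  extend-consistent : ∀ Θ αs → Not (Θ ⊩ ψ) → Not (extend Θ αs ⊩ ψ)
  extend-consistent Θ []       c = c
  extend-consistent Θ (α ∷ αs) c =
    extend-consistent (step Θ α) αs (step-consistent Θ α c)

  stage : ℕ → Pred For 0ℓ
  stage zero    = Γ
  stage (suc n) = extend (stage n) (formulas n)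

  stage-mono′ : ∀ {m n} → m ≤′ n → stage m ⊆ stage n
  stage-mono′ ≤′-refl         p = p
  stage-mono′ (≤′-step {n} l) p = ⊆-extend (stage n) (formulas n) (stage-mono′ l p)

  stage-mono : ∀ {m n} → m ≤ n → stage m ⊆ stage n
  stage-mono l = stage-mono′ (≤⇒≤′ l)

  stage-consistent : ∀ n → Not (stage n ⊩ ψ)
  stage-consistent zero    = Γ⊮ψ
  stage-consistent (suc n) = extend-consistent (stage n) (formulas n) (stage-consistent n)

  Ω : Pred For 0ℓ
  Ω = ⋃[ n ∶ ℕ ] stage n

  -- A derivation uses finitely many premises and the stages increase, so one late stage contains
  -- them all.
  Ω-compact : Ω ⊩ φ → ∃[ n ] stage n ⊩ φ
  Ω-compact (hyp (n , p)) = n , hyp p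
  Ω-compact (thm p)       = 0 , thm p
  Ω-compact (mp p q) =
    let m , p′ = Ω-compact p
        n , q′ = Ω-compact q
    in m ⊔ n , mp (weaken (stage-mono (m≤m⊔n m n)) p′) (weaken (stage-mono (m≤n⊔m m n)) q′)

  Ω-consistent : Not (Ω ⊩ ψ)
  Ω-consistent p = let n , q = Ω-compact p in stage-consistent n q

  Ω-maximal : ∀ {α} → Not (Ω ⊩ α) → Ω ⊩ α ⇒ ψ
  Ω-maximal {α} ¬p
    -- `α` occurs in `formulas (depth α)`, which is processed in passing to stage `suc (depth α)`.
    with extend-decides (stage (depth α)) (formulas (depth α)) (∈-formulas α ≤-refl)
  ... | inj₁ i = ⊥-elim (¬p (hyp (suc (depth α) , i)))
  ... | inj₂ q = weaken (suc (depth α) ,_) q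

  -- If `β` failed as well, both disjuncts would imply `ψ`, and `Ω` would derive it.
  Ω-prime : ∀ {α β} → Ω ⊩ α ∨ β → Not (Ω ⊩ α) → Ω ⊩ β
  Ω-prime {β = β} d ¬a with em {Ω ⊩ β}
  ... | yes b = b
  ... | no ¬b = ⊥-elim (Ω-consistent (∨-cases d (Ω-maximal ¬a) (Ω-maximal ¬b)))

  Ω-hom : ∀ # α β → does (em {Ω ⊩ α ⟨ # ⟩ β}) ≡ boolOp # (does (em {Ω ⊩ α})) (does (em {Ω ⊩ β}))
  Ω-hom and α β with em {Ω ⊩ α} | em {Ω ⊩ β}
  ... | yes a | yes b = dec-true em (mp (mp (ax (∧-I α β)) a) b)
  ... | yes a | no ¬b = dec-false em (λ p → ¬b (mp (ax (∧-E₂ α β)) p))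
  ... | no ¬a | _     = dec-false em (λ p → ¬a (mp (ax (∧-E₁ α β)) p))
  Ω-hom or α β with em {Ω ⊩ α} | em {Ω ⊩ β}
  ... | yes a | _     = dec-true em (mp (ax (∨-I₁ α β)) a)
  ... | no ¬a | yes b = dec-true em (mp (ax (∨-I₂ α β)) b)
  ... | no ¬a | no ¬b = dec-false em (λ p → ¬b (Ω-prime p ¬a))
  Ω-hom imp α β with em {Ω ⊩ α} | em {Ω ⊩ β}
  -- Here classical implication enters: by primeness, `∨-⇒` leaves only `α ⇒ β`.
  ... | no ¬a | _     = dec-true em (Ω-prime (ax (∨-⇒ α β)) ¬a)
  ... | yes a | yes b = dec-true em (mp (ax (→-K β α)) b)
  ... | yes a | no ¬b = dec-false em (λ p → ¬b (mp p a))

  world : World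
  world = record
    { holds     = λ α → does (em {Ω ⊩ α})
    ; hom       = Ω-hom
    ; sound     = λ p → dec-true em (thm p)
    ; bot-false = λ _ → dec-false em (λ p → Ω-consistent (explosion p))
    }

  lindenbaum : ∃[ w ] (∀ γ → γ ∈ Γ → holds w γ ≡ true) × holds w ψ ≡ false
  lindenbaum =
    world , (λ _ γ∈Γ → dec-true em (hyp (0 , γ∈Γ))) , dec-false em Ω-consistent

-- The swap valuation induced by a world.

pair : Bool → Bool → A
pair true  true  = t
pair true  false = T
-- The pair `(false , false)` names no value; `excluded` shows that it does not arise at a world.
pair false _     = F

pair-₁ : ∀ b c → pair b c ₁ ≡ b
pair-₁ true  true  = refl
pair-₁ true  false = refl
pair-₁ false _     = refl

module Valuation (w : World) where
  open World w hiding (holds)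

  h : For → Bool
  h = holds w

  v : For → A
  v α = pair (h α) (h (¬ α))

  -- The truth lemma, here by computation: the values of all formulas are read off `h` at once.
  v-₁ : ∀ α → v α ₁ ≡ h α
  v-₁ α = pair-₁ (h α) (h (¬ α))

  excluded : ∀ α → h α 𝔹.∨ h (¬ α) ≡ true
  excluded α = trans (sym (hom or α (¬ α))) (sound (axiom (EM α)))

  h-contradiction : ∀ α → h (α ∧ ¬ α) ≡ h α 𝔹.∧ h (¬ α)
  h-contradiction α = hom and α (¬ α)

  h-¬○ : ∀ α → h (¬ (○ α)) ≡ true → h α 𝔹.∧ h (¬ α) ≡ true
  h-¬○ α p = trans (sym (h-contradiction α)) (modus-ponens (axiom (ci α)) p)

  h-bot : ∀ α → (h α 𝔹.∧ h (¬ α)) 𝔹.∧ h (○ α) ≡ false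
  h-bot α =
    trans (cong (𝔹._∧ h (○ α)) (sym (h-contradiction α)))
      (trans (sym (hom and (α ∧ ¬ α) (○ α))) (bot-false α))

  -- Value `t` together with a true `○ α` would verify `bot α`.
  ○⇒classical : ∀ α → h (○ α) ≡ true → v α ∈ Classical
  ○⇒classical α c with h α | h (¬ α) | h (○ α) | h-bot α
  ○⇒classical α c  | true  | false | _     | _  = inj₁ refl
  ○⇒classical α c  | false | _     | _     | _  = inj₂ refl
  ○⇒classical α () | true  | true  | false | _
  ○⇒classical α c  | true  | true  | true  | ()

  -- If `○ α` failed, `EM` would give `¬ (○ α)`, and `ci` would make `α` and `¬ α` both true, which
  -- is value `t`.
  classical⇒○ : ∀ α → v α ∈ Classical → h (○ α) ≡ true
  classical⇒○ α c with h (○ α) | h (¬ (○ α)) | excluded (○ α) | h-¬○ α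
  ... | true  | _    | _ | _ = refl
  ... | false | true | _ | f with h α | h (¬ α) | f refl
  classical⇒○ α (inj₁ ()) | false | true | _ | f | true | true | _
  classical⇒○ α (inj₂ ()) | false | true | _ | f | true | true | _

  v-binary : ∀ # α β → v (α ⟨ # ⟩ β) ∈ binary~ # (v α) (v β)
  v-binary # α β rewrite v-₁ (α ⟨ # ⟩ β) | v-₁ α | v-₁ β = hom # α β

  v-¬ : ∀ α → v (¬ α) ∈ ¬~ (v α)
  v-¬ α with h α | h (¬ α) | h (¬ (¬ α)) | excluded α | modus-ponens (axiom (cf α))
  ... | true  | true  | c     | _ | _ = pair-₁ true c , ≤-maximum _
  ... | true  | false | c     | _ | _ = refl , ≤-maximum _
  ... | false | true  | false | _ | _ = refl , ≤-minimum _
  -- For false `α`, the bound on the second coordinate demands that `¬ (¬ α)` be false; `cf` ensures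
  -- it.
  ... | false | true  | true  | _ | f with () ← f refl

  -- Where `α` has value `t`, `h-bot` makes `○ α` false. Elsewhere `ci` refutes `¬ (○ α)`, and `EM`
  -- then makes `○ α` true.
  v-○ : ∀ α → v (○ α) ∈ ○~ (v α)
  v-○ α with h α | h (¬ α) | h (○ α) | h (¬ (○ α)) | excluded (○ α) | h-¬○ α | h-bot α
  ... | true  | true  | true  | _     | _ | _ | ()
  ... | true  | true  | false | _     | _ | _ | _ = refl
  ... | true  | false | true  | false | _ | _ | _ = refl
  ... | true  | false | _     | true  | _ | f | _ with () ← f refl
  ... | false | _     | true  | false | _ | _ | _ = refl
  ... | false | _     | _     | true  | _ | f | _ with () ← f refl

  -- A true `¬ (α ∧ ¬ α)` would give `○ α` by `cl`, and hence `bot α`.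
  v-cl : ∀ α → v α ≡ t → v (α ∧ ¬ α) ≡ T
  v-cl α e
    with h α | h (¬ α) | h (○ α) | h (α ∧ ¬ α) | h (¬ (α ∧ ¬ α))
       | h-contradiction α | h-bot α | modus-ponens (axiom (cl α))
  ... | true | true | _     | true | false | _ | _  | _ = refl
  ... | true | true | true  | true | true  | _ | () | _
  ... | true | true | false | true | true  | _ | _  | f with () ← f refl

  v-ca : ∀ # α β → v α ∈ Classical → v β ∈ Classical → v (α ⟨ # ⟩ β) ∈ Classical
  v-ca # α β a b = ○⇒classical (α ⟨ # ⟩ β) (modus-ponens (axiom (ca # α β)) both)
    where
    both : h (○ α ∧ ○ β) ≡ true
    both rewrite hom and (○ α) (○ β) | classical⇒○ α a | classical⇒○ β b = refl

  holds⇒designated : ∀ {α} → h α ≡ true → v α ∈ Designated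
  holds⇒designated {α} p with h α | h (¬ α)
  ... | true | true  = inj₂ refl
  ... | true | false = inj₁ refl

  designated⇒holds : ∀ {α} → v α ∈ Designated → h α ≡ true
  designated⇒holds {α} (inj₁ e) = trans (sym (v-₁ α)) (cong _₁ (sym e))
  designated⇒holds {α} (inj₂ e) = trans (sym (v-₁ α)) (cong _₁ (sym e))

  Unboxed : Pred For 0ℓ
  Unboxed β = h (O β) ≡ true

  -- `O` passes through a derivation: `O-nec` serves its theorems and `O-K` its uses of `mp`.
  unboxed-closed : Unboxed ⊩ φ → h (O φ) ≡ true
  unboxed-closed (hyp p) = p
  unboxed-closed (thm p) = sound (O-nec p)
  unboxed-closed (mp {α} {β} p q)
    with h (O α) | h (O β) | hom imp (O α) (O β) | unboxed-closed q
       | modus-ponens (axiom (O-K α β)) (unboxed-closed p)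
  ... | true | true  | _ | _ | _ = refl
  ... | true | false | e | _ | s = trans (sym e) s

-- Accessibility and the canonical model

module Canonical (em : ExcludedMiddle 0ℓ) where
  open Valuation

  R : World → World → Set
  R w w′ = ∀ α → h w (O α) ≡ true → h w′ α ≡ true

  -- By `unboxed-closed`, `Unboxed w` does not derive `α`. That a world verifies all of `Unboxed w`
  -- is precisely accessibility from `w`.
  refuting-successor : ∀ w α → h w (O α) ≡ false → ∃[ w′ ] R w w′ × h w′ α ≡ false
  refuting-successor w α e = Lindenbaum.lindenbaum em (Unboxed w) α
    (λ p → true≢false (trans (sym (unboxed-closed w p)) e))
    where
    true≢false : Not (true ≡ false)
    true≢false ()

  serial : ∀ w → ∃[ w′ ] R w w′
  serial w =
    -- The variable is arbitrary: `O-E` refutes `O (bot α)` for every `α`.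
    let w′ , r , _ = refuting-successor w (bot (var 0)) O-bot-false in w′ , r
    where
    O-bot-false : h w (O (bot (var 0))) ≡ false
    O-bot-false with h w (O (bot (var 0))) | World.modus-ponens w (axiom (O-E (var 0)))
    ... | false | _ = refl
    ... | true  | f = trans (sym (f refl)) (World.bot-false w (var 0))

  v-O : ∀ w α → v w (O α) ∈ O~ (λ x → ∃[ w′ ] R w w′ × v w′ α ≡ x)
  v-O w α rewrite v-₁ w (O α) = lower , greatest
    where
    S : Pred Bool 0ℓ
    S b = ∃[ x ] (∃[ w′ ] R w w′ × v w′ α ≡ x) × x ₁ ≡ b

    lower : ∀ s → s ∈ S → h w (O α) 𝔹.≤ s
    lower _ (_ , (w′ , r , refl) , refl) rewrite v-₁ w′ α with h w (O α) | r α
    ... | false | _ = ≤-minimum _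
    ... | true  | f rewrite f refl = ≤-maximum _

    greatest : ∀ d → (∀ s → s ∈ S → d 𝔹.≤ s) → d 𝔹.≤ h w (O α)
    greatest d lb with h w (O α) in e
    ... | true  = ≤-maximum d
    ... | false =
      -- The refuting successor puts `false` into `S`, which bounds `d`.
      let w′ , r , f = refuting-successor w α e
      in lb false (v w′ α , (w′ , r , refl) , trans (v-₁ w′ α) f)

  model : World → Model
  model w = record
    { W        = World
    ; w₀       = w
    ; R        = R
    ; serial   = serial
    ; v        = v
    ; v-binary = v-binary
    ; v-¬      = v-¬
    ; v-○      = v-○
    ; v-O      = v-O
    ; v-cl     = v-cl
    ; v-ca     = v-ca
    }

theorem5p6 : ExcludedMiddle 0ℓ → (Γ : Pred For 0ℓ) (φ : For) → Γ ⊨ φ → Γ ⊢ φ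
theorem5p6 em Γ φ Γ⊨φ with em {Γ ⊩ φ}
... | yes p = ⊩⇒⊢ p
... | no ¬p
  -- A world verifying `Γ` and refuting `φ` is itself a point of the canonical model, against `Γ⊨φ`.
  with w , Γ-true , φ-false ← Lindenbaum.lindenbaum em Γ φ ¬p
  with () ← trans (sym φ-false) (Valuation.designated⇒holds w
         (Γ⊨φ (Canonical.model em w) w
           (λ γ γ∈Γ → Valuation.holds⇒designated w (Γ-true γ γ∈Γ))))
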